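{- (i) Let $n\ge 5$ be odd and $\frac{n+1}{2}\le p\le n-2$, and put $r=\sum_{i=0}^{p-\frac{n-1}{2}}\binom{n}{i}$. Then $b(Q_n^p)\le 2^{n-1}+\lceil r/2\rceil-1$. (ii) Let $n\ge 6$ be even and $\frac{n}{2}+1\le p\le n-2$, and put $r'=\sum_{i=0}^{p-\frac{n}{2}}\binom{n}{i}+\binom{n-1}{p-\frac{n}{2}}$. Then $b(Q_n^p)\le 2^{n-1}+\lceil r'/2\rceil-1$.
   Context: The hypercube $Q_n$ has vertex set the power set $2^{[n]}$ of $[n]=\{1,\dots,n\}$, with $x,y$ adjacent iff $|x\triangle y|=1$. The $p$-th power $Q_n^p$ has the same vertex set, with distinct $x,y$ adjacent iff $|x\triangle y|\le p$. A b-coloring of a graph $G$ with $k$ colors is a proper vertex coloring with $k$ colors in which every color class contains a vertex adjacent to at least one vertex of every other color class; the b-chromatic number $b(G)$ is the largest $k$ for which $G$ has a b-coloring with $k$ colors. -}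

module Defs where

open import Data.Nat using (ℕ; zero; suc; _+_; _≤_)
open import Data.Bool using (_xor_)
open import Data.Fin using (Fin)
open import Data.Fin.Subset using (Subset; ∣_∣)
open import Data.Vec using (zipWith)
open import Data.Product using (Σ; ∃; _×_)
open import Relation.Binary.PropositionalEquality using (_≡_; _≢_)

-- Vertices of Q_n: subsets of [n], i.e. Subset n (characteristic vectors).
-- Symmetric difference x △ y.
_△_ : ∀ {n} → Subset n → Subset n → Subset n
x △ y = zipWith _xor_ x y

AdjQ : (n p : ℕ) → Subset n → Subset n → Set
AdjQ n p x y = (x ≢ y) × (∣ x △ y ∣ ≤ p)

Proper : {V : Set} → (V → V → Set) → (k : ℕ) → (V → Fin k) → Set
Proper {V} Adj k c = ∀ (x y : V) → Adj x y → c x ≢ c y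

IsBColoring : {V : Set} → (V → V → Set) → (k : ℕ) → (V → Fin k) → Set
IsBColoring {V} Adj k c =
  Proper Adj k c ×
  (∀ (i : Fin k) → Σ V λ x → (c x ≡ i) ×
     (∀ (j : Fin k) → j ≢ i → Σ V λ y → Adj x y × (c y ≡ j)))

-- "b(G) ≤ B": every b-colouring of G uses at most B colours
-- (b(G) is the largest such k, so this is exactly b(G) ≤ B).
BChromatic≤ : {V : Set} → (V → V → Set) → ℕ → Set
BChromatic≤ {V} Adj B = ∀ (k : ℕ) (c : V → Fin k) → IsBColoring Adj k c → k ≤ B

sumTo : ℕ → (ℕ → ℕ) → ℕ
sumTo zero    f = f zero
sumTo (suc m) f = sumTo m f + f (suc m)

{-# OPTIONS --safe #-}

-- Choose a b-vertex in every colour class; let X be the set of these k vertices and let S consist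
-- of the vertices that are alone in their class.  Every x ∈ X is adjacent or equal to every y ∈ S,
-- so all distances between X and S are at most p, and counting gives 2k ≤ 2ⁿ + |S|.  Were the
-- bound violated, then |X| > 2ⁿ⁻¹ and |S| ≥ r.  Following Frankl and Füredi's proof of Harper's
-- theorem, replace X and S by families of the same sizes that are downward closed for a weight,
-- without increasing the largest distance: flip the coordinates in D whenever this lowers the
-- weight, taking D minimal among the flips that still change something.  After that S contains
-- all vertices of weight at most t (t = p − (n−1)/2 or p − n/2) and X contains one of weight
-- beyond the middle, which yields a pair at distance greater than p.

module Submission where

open import Defs
open import Algebra.Properties.CommutativeSemigroup using (interchange)
open import Data.Bool using (Bool; true; false; _∧_; _∨_; not; _xor_)
import Data.Bool as Bool
open import Data.Bool.Properties using (xor-assoc; xor-comm; xor-same; xor-identityˡ; T-≡)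
open import Data.Empty using (⊥; ⊥-elim)
open import Data.Fin using (Fin; toℕ; fromℕ<)
import Data.Fin as Fin
open import Data.Fin.Properties using (toℕ-fromℕ<)
open import Data.Fin.Subset using (Subset; ∣_∣; _∩_; ∁; ⊤)
import Data.Fin.Subset as FS
open import Data.Fin.Subset.Properties using (anySubset?; ∣p∣≤n; ∣⊥∣≡0; ∩-assoc)
open import Data.Nat using (ℕ; zero; suc; _+_; _*_; _∸_; _^_; _≤_; _<_; _<ᵇ_; _≡ᵇ_; _/_; _%_;
  ⌈_/2⌉; ⌊_/2⌋; z≤n; s≤s; _<?_; _≤?_)
open import Data.Nat.Combinatorics using (_C_; nCk+nC[k+1]≡[n+1]C[k+1])
open import Data.Nat.DivMod using (m≡m%n+[m/n]*n; m*n/n≡m; /-monoˡ-≤)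
open import Data.Nat.Induction using (<-wellFounded)
open import Data.Nat.Properties
open import Data.Nat.Tactic.RingSolver using (solve-∀)
open import Data.Product using (Σ; ∃; _×_; _,_; proj₁; proj₂)
open import Data.Sum using (_⊎_; inj₁; inj₂)
open import Data.Vec using ([]; _∷_; tail)
open import Data.Vec.Properties using (zipWith-assoc; zipWith-comm; ≡-dec)
open import Function using (_∘_; Equivalence)
open import Induction.WellFounded using (Acc; acc)
open import Relation.Binary.Definitions using (Tri; tri<; tri≈; tri>)
open import Relation.Binary.PropositionalEquality
open import Relation.Nullary using (Dec; yes; no; ¬_; does; contradiction)
open import Relation.Nullary.Decidable using (_×-dec_; _⊎-dec_; ¬?; dec-true)

private
  variable
    n : ℕ

-- Identities between cardinalities

bit : Bool → ℕ
bit true  = 1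
bit false = 0

∣∷∣ : ∀ b (x : Subset n) → ∣ b ∷ x ∣ ≡ bit b + ∣ x ∣
∣∷∣ true  x = refl
∣∷∣ false x = refl

∣∷∣-+-cong : ∀ {k l m n} a b c d (x : Subset k) (y : Subset l) (u : Subset m) (v : Subset n) →
  bit a + bit b ≡ bit c + bit d → ∣ x ∣ + ∣ y ∣ ≡ ∣ u ∣ + ∣ v ∣ →
  ∣ a ∷ x ∣ + ∣ b ∷ y ∣ ≡ ∣ c ∷ u ∣ + ∣ d ∷ v ∣
∣∷∣-+-cong a b c d x y u v p q
  rewrite ∣∷∣ a x | ∣∷∣ b y | ∣∷∣ c u | ∣∷∣ d v
  = trans (interchange +-commutativeSemigroup (bit a) (∣ x ∣) (bit b) (∣ y ∣))
      (trans (cong₂ _+_ p q) (sym (interchange +-commutativeSemigroup (bit c) (∣ u ∣) (bit d) (∣ v ∣))))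

△-assoc : (x y z : Subset n) → (x △ y) △ z ≡ x △ (y △ z)
△-assoc = zipWith-assoc xor-assoc

△-comm : (x y : Subset n) → x △ y ≡ y △ x
△-comm = zipWith-comm xor-comm

x△[x△y]≡y : (x y : Subset n) → x △ (x △ y) ≡ y
x△[x△y]≡y []       []       = refl
x△[x△y]≡y (a ∷ x) (b ∷ y) = cong₂ _∷_
  (trans (sym (xor-assoc a a b)) (trans (cong (_xor b) (xor-same a)) (xor-identityˡ b)))
  (x△[x△y]≡y x y)

[x△y]△y≡x : (x y : Subset n) → (x △ y) △ y ≡ x
[x△y]△y≡x x y = trans (△-comm (x △ y) y) (trans (cong (y △_) (△-comm x y)) (x△[x△y]≡y y x))

[x△y]△z≡[x△z]△y : (x y z : Subset n) → (x △ y) △ z ≡ (x △ z) △ y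
[x△y]△z≡[x△z]△y x y z =
  trans (△-assoc x y z) (trans (cong (x △_) (△-comm y z)) (sym (△-assoc x z y)))

[x△z]△[y△z]≡x△y : (x y z : Subset n) → (x △ z) △ (y △ z) ≡ x △ y
[x△z]△[y△z]≡x△y x y z =
  trans (sym (△-assoc (x △ z) y z))
    (trans (cong (_△ z) ([x△y]△z≡[x△z]△y x z y)) ([x△y]△y≡x (x △ y) z))

[[x△z]△y]△z≡x△y : (x y z : Subset n) → ((x △ z) △ y) △ z ≡ x △ y
[[x△z]△y]△z≡x△y x y z = trans ([x△y]△z≡[x△z]△y (x △ z) y z) (cong (_△ y) ([x△y]△y≡x x z))

∣x△x∣≡0 : (x : Subset n) → ∣ x △ x ∣ ≡ 0
∣x△x∣≡0 []          = refl
∣x△x∣≡0 (true ∷ x)  = ∣x△x∣≡0 x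
∣x△x∣≡0 (false ∷ x) = ∣x△x∣≡0 x

∣e△D∣+2∣D∩e∣ : (e D : Subset n) → ∣ e △ D ∣ + (∣ D ∩ e ∣ + ∣ D ∩ e ∣) ≡ ∣ e ∣ + ∣ D ∣
∣e△D∣+2∣D∩e∣ []          []          = refl
∣e△D∣+2∣D∩e∣ (true ∷ e)  (true ∷ D)  =
  trans (lemma (∣ e △ D ∣) (∣ D ∩ e ∣)) (trans (cong (suc ∘ suc) (∣e△D∣+2∣D∩e∣ e D)) (sym (cong suc (+-suc _ _))))
  where
  lemma : ∀ a i → a + (suc i + suc i) ≡ suc (suc (a + (i + i)))
  lemma = solve-∀
∣e△D∣+2∣D∩e∣ (true ∷ e)  (false ∷ D) = cong suc (∣e△D∣+2∣D∩e∣ e D)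
∣e△D∣+2∣D∩e∣ (false ∷ e) (true ∷ D)  = trans (cong suc (∣e△D∣+2∣D∩e∣ e D)) (sym (+-suc _ _))
∣e△D∣+2∣D∩e∣ (false ∷ e) (false ∷ D) = ∣e△D∣+2∣D∩e∣ e D

-- Every coordinate of `D ∩ (e ∩ K)` lies in both `e` and `D`, hence outside `e △ D`, so the
-- symmetric difference is a disjoint union.
∣[e△D]△[D∩[e∩K]]∣ : (e D K : Subset n) →
  ∣ (e △ D) △ (D ∩ (e ∩ K)) ∣ ≡ ∣ e △ D ∣ + ∣ D ∩ (e ∩ K) ∣
∣[e△D]△[D∩[e∩K]]∣ [] [] [] = refl
∣[e△D]△[D∩[e∩K]]∣ (true ∷ e)  (true ∷ D)  (true ∷ K)  =
  trans (cong suc (∣[e△D]△[D∩[e∩K]]∣ e D K)) (sym (+-suc _ _))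
∣[e△D]△[D∩[e∩K]]∣ (true ∷ e)  (true ∷ D)  (false ∷ K) = ∣[e△D]△[D∩[e∩K]]∣ e D K
∣[e△D]△[D∩[e∩K]]∣ (true ∷ e)  (false ∷ D) (k ∷ K)     = cong suc (∣[e△D]△[D∩[e∩K]]∣ e D K)
∣[e△D]△[D∩[e∩K]]∣ (false ∷ e) (true ∷ D)  (k ∷ K)     = cong suc (∣[e△D]△[D∩[e∩K]]∣ e D K)
∣[e△D]△[D∩[e∩K]]∣ (false ∷ e) (false ∷ D) (k ∷ K)     = ∣[e△D]△[D∩[e∩K]]∣ e D K

-- On D ∩ ((f △ D) △ g) the sets f and g agree, so flipping a part of it has the same effect on both.
∣△∣-agree : (f g D K : Subset n) → let M = D ∩ (((f △ D) △ g) ∩ K) in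
  ∣ g △ M ∣ + ∣ f ∣ ≡ ∣ f △ M ∣ + ∣ g ∣
∣△∣-agree [] [] [] [] = refl
∣△∣-agree (a ∷ f) (b ∷ g) (d ∷ D) (k ∷ K) =
  ∣∷∣-+-cong (b xor M) a (a xor M) b (g △ N) f (f △ N) g (bits a b d k) (∣△∣-agree f g D K)
  where
  N = D ∩ (((f △ D) △ g) ∩ K)
  M = d ∧ (((a xor d) xor b) ∧ k)
  bits : ∀ a b d k → let M = d ∧ (((a xor d) xor b) ∧ k) in
    bit (b xor M) + bit a ≡ bit (a xor M) + bit b
  bits true  true  d     k     = refl
  bits false false d     k     = refl
  bits true  false true  k     = refl
  bits true  false false k     = refl
  bits false true  true  k     = refl
  bits false true  false k     = refl

-- Both sides count the union of `f` and `E`.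
∣f∣+∣E∩∁f∣ : (f E : Subset n) → ∣ f ∣ + ∣ E ∩ ∁ f ∣ ≡ ∣ f △ E ∣ + ∣ E ∩ f ∣
∣f∣+∣E∩∁f∣ [] [] = refl
∣f∣+∣E∩∁f∣ (a ∷ f) (e ∷ E) =
  ∣∷∣-+-cong a (e ∧ not a) (a xor e) (e ∧ a) f (E ∩ ∁ f) (f △ E) (E ∩ f) (bits a e) (∣f∣+∣E∩∁f∣ f E)
  where
  bits : ∀ a e → bit a + bit (e ∧ not a) ≡ bit (a xor e) + bit (e ∧ a)
  bits true  true  = refl
  bits true  false = refl
  bits false true  = refl
  bits false false = refl

∣E∩f∣+∣E∩∁f∣ : (f E : Subset n) → ∣ E ∩ f ∣ + ∣ E ∩ ∁ f ∣ ≡ ∣ E ∣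
∣E∩f∣+∣E∩∁f∣ [] [] = refl
∣E∩f∣+∣E∩∁f∣ (a ∷ f)     (false ∷ E) = ∣E∩f∣+∣E∩∁f∣ f E
∣E∩f∣+∣E∩∁f∣ (true ∷ f)  (true ∷ E)  = cong suc (∣E∩f∣+∣E∩∁f∣ f E)
∣E∩f∣+∣E∩∁f∣ (false ∷ f) (true ∷ E)  = trans (+-suc _ _) (cong suc (∣E∩f∣+∣E∩∁f∣ f E))

∣D∩X∣≤∣D∣ : (D X : Subset n) → ∣ D ∩ X ∣ ≤ ∣ D ∣
∣D∩X∣≤∣D∣ [] [] = z≤n
∣D∩X∣≤∣D∣ (false ∷ D) (x ∷ X)     = ∣D∩X∣≤∣D∣ D X
∣D∩X∣≤∣D∣ (true ∷ D)  (true ∷ X)  = s≤s (∣D∩X∣≤∣D∣ D X)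
∣D∩X∣≤∣D∣ (true ∷ D)  (false ∷ X) = m≤n⇒m≤1+n (∣D∩X∣≤∣D∣ D X)

∣D∩X∣<∣D∣⊎≡ : (D X : Subset n) → ∣ D ∩ X ∣ < ∣ D ∣ ⊎ D ∩ X ≡ D
∣D∩X∣<∣D∣⊎≡ [] [] = inj₂ refl
∣D∩X∣<∣D∣⊎≡ (true ∷ D) (false ∷ X) = inj₁ (s≤s (∣D∩X∣≤∣D∣ D X))
∣D∩X∣<∣D∣⊎≡ (false ∷ D) (x ∷ X) with ∣D∩X∣<∣D∣⊎≡ D X
... | inj₁ lt = inj₁ lt
... | inj₂ eq = inj₂ (cong (false ∷_) eq)
∣D∩X∣<∣D∣⊎≡ (true ∷ D) (true ∷ X) with ∣D∩X∣<∣D∣⊎≡ D X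
... | inj₁ lt = inj₁ (s≤s lt)
... | inj₂ eq = inj₂ (cong (true ∷_) eq)

-- Triangle inequality: `D ∩ e` and `D` differ in exactly `∣ D ∣ - ∣ D ∩ e ∣` coordinates.
∣f△[D∩e]∣-bound : (f D e : Subset n) → ∣ f △ (D ∩ e) ∣ + ∣ D ∩ e ∣ ≤ ∣ f △ D ∣ + ∣ D ∣
∣f△[D∩e]∣-bound [] [] [] = z≤n
∣f△[D∩e]∣-bound (true ∷ f)  (false ∷ D) (e ∷ E)     = s≤s (∣f△[D∩e]∣-bound f D E)
∣f△[D∩e]∣-bound (false ∷ f) (false ∷ D) (e ∷ E)     = ∣f△[D∩e]∣-bound f D E
∣f△[D∩e]∣-bound (true ∷ f)  (true ∷ D)  (true ∷ E)
  rewrite +-suc (∣ f △ (D ∩ E) ∣) (∣ D ∩ E ∣) | +-suc (∣ f △ D ∣) (∣ D ∣) = s≤s (∣f△[D∩e]∣-bound f D E)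
∣f△[D∩e]∣-bound (true ∷ f)  (true ∷ D)  (false ∷ E)
  rewrite +-suc (∣ f △ D ∣) (∣ D ∣) = s≤s (∣f△[D∩e]∣-bound f D E)
∣f△[D∩e]∣-bound (false ∷ f) (true ∷ D)  (true ∷ E)
  rewrite +-suc (∣ f △ (D ∩ E) ∣) (∣ D ∩ E ∣) | +-suc (∣ f △ D ∣) (∣ D ∣) = s≤s (s≤s (∣f△[D∩e]∣-bound f D E))
∣f△[D∩e]∣-bound (false ∷ f) (true ∷ D)  (false ∷ E)
  rewrite +-suc (∣ f △ D ∣) (∣ D ∣) = m≤n⇒m≤1+n (m≤n⇒m≤1+n (∣f△[D∩e]∣-bound f D E))

-- `K` leaves out exactly `k` coordinates of `E` outside `f`; each of them counts once in `E` and
-- once in `f △ E`.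
discard : (f E : Subset n) → ∀ k → k ≤ ∣ E ∩ ∁ f ∣ →
  ∃ λ K → (∣ E ∩ K ∣ + k ≡ ∣ E ∣) × (∣ f △ (E ∩ K) ∣ + k ≡ ∣ f △ E ∣)
discard [] [] zero _ = [] , refl , refl
discard (true ∷ f) (true ∷ E) k le with discard f E k le
... | K , p , q = true ∷ K , cong suc p , q
discard (true ∷ f) (false ∷ E) k le with discard f E k le
... | K , p , q = true ∷ K , p , cong suc q
discard (false ∷ f) (false ∷ E) k le with discard f E k le
... | K , p , q = true ∷ K , p , q
discard (false ∷ f) (true ∷ E) zero le with discard f E zero z≤n
... | K , p , q = true ∷ K , cong suc p , cong suc q
discard (false ∷ f) (true ∷ E) (suc k) (s≤s le) with discard f E k le
... | K , p , q = false ∷ K , trans (+-suc _ _) (cong suc p) , trans (+-suc _ _) (cong suc q)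

-- The weight ignores the first coordinate, so that in an even dimension
-- {x | wt x ≤ t} has exactly r' elements.
wt : Subset (suc n) → ℕ
wt x = ∣ tail x ∣

wt-△-agree : (f g D K : Subset (suc n)) → let M = D ∩ (((f △ D) △ g) ∩ K) in
  wt (g △ M) + wt f ≡ wt (f △ M) + wt g
wt-△-agree (_ ∷ f) (_ ∷ g) (_ ∷ D) (_ ∷ K) = ∣△∣-agree f g D K

-- Take out of D ∩ e coordinates not in f, one at a time, until flipping the rest lowers the weight
-- of f: each removal decreases the weight of the flipped set by one.
shrink : (f D e : Subset (suc n)) → wt (f △ D) < wt f → ∣ D ∣ < ∣ D ∩ e ∣ + ∣ D ∩ e ∣ →
  ∃ λ K → (∣ D ∩ e ∣ + ∣ D ∩ e ∣ ≤ ∣ D ∣ + ∣ (D ∩ e) ∩ K ∣) × wt (f △ ((D ∩ e) ∩ K)) < wt f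
shrink {n} (h ∷ f) (d ∷ D) (c ∷ e) lt big = true ∷ K , size-ok , weight-ok
  where
  E = D ∩ e
  a = ∣ f △ E ∣
  b = ∣ f ∣
  -- The least number of removals that brings `a` below `b`; it is 0 if `a < b` already.
  k = suc a ∸ b
  ∣E∣⁺ = ∣ (d ∷ D) ∩ (c ∷ e) ∣
  ∣D∣⁺ = ∣ d ∷ D ∣

  head-bound : ∀ d c → ∣ f △ E ∣ + ∣ (d ∷ D) ∩ (c ∷ e) ∣ ≤ ∣ f △ D ∣ + ∣ d ∷ D ∣
  head-bound false c = ∣f△[D∩e]∣-bound f D e
  head-bound true true = subst₂ _≤_ (sym (+-suc _ _)) (sym (+-suc _ _)) (s≤s (∣f△[D∩e]∣-bound f D e))
  head-bound true false = ≤-trans (∣f△[D∩e]∣-bound f D e) (+-monoʳ-≤ (∣ f △ D ∣) (n≤1+n _))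

  bound : suc a + ∣E∣⁺ ≤ b + ∣D∣⁺
  bound = ≤-trans (s≤s (head-bound d c)) (+-monoˡ-≤ ∣D∣⁺ lt)

  ∣E∣⁺≤ : ∣E∣⁺ ≤ suc (∣ E ∣)
  ∣E∣⁺≤ with d ∧ c
  ... | true  = ≤-refl
  ... | false = n≤1+n _

  -- If `E` avoided `f`, then `a` would equal `b + ∣ E ∣`, and `bound` would force
  -- `∣E∣⁺ + ∣E∣⁺ ≤ ∣D∣⁺`, against `big`. This one common coordinate guarantees in `k≤` that enough
  -- coordinates can be removed.
  E∩f-nonempty : 1 ≤ ∣ E ∩ f ∣
  E∩f-nonempty with ∣ E ∩ f ∣ in eq
  ... | suc _ = s≤s z≤n
  ... | zero  = contradiction big (≤⇒≯ (+-cancelˡ-≤ b _ _ (begin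
      b + (∣E∣⁺ + ∣E∣⁺)        ≤⟨ +-monoʳ-≤ b (+-monoˡ-≤ ∣E∣⁺ ∣E∣⁺≤) ⟩
      b + (suc (∣ E ∣) + ∣E∣⁺) ≡⟨ shuffle b (∣ E ∣) ∣E∣⁺ ⟩
      suc (b + ∣ E ∣) + ∣E∣⁺   ≡⟨ cong (λ z → suc z + ∣E∣⁺) b+∣E∣≡a ⟩
      suc a + ∣E∣⁺             ≤⟨ bound ⟩
      b + ∣D∣⁺                 ∎)))
    where
    open ≤-Reasoning
    shuffle : ∀ b E E⁺ → b + (suc E + E⁺) ≡ suc (b + E) + E⁺
    shuffle = solve-∀
    b+∣E∣≡a : b + ∣ E ∣ ≡ a
    b+∣E∣≡a = trans (cong (b +_) (trans (sym (∣E∩f∣+∣E∩∁f∣ f E)) (cong (_+ ∣ E ∩ ∁ f ∣) eq)))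
      (trans (∣f∣+∣E∩∁f∣ f E) (trans (cong (a +_) eq) (+-identityʳ a)))

  k≤ : k ≤ ∣ E ∩ ∁ f ∣
  k≤ = m≤n+o⇒m∸n≤o (suc a) b (subst₂ _≤_ (+-comm a 1) (sym (∣f∣+∣E∩∁f∣ f E)) (+-monoʳ-≤ a E∩f-nonempty))

  discarded = discard f E k k≤
  K = proj₁ discarded

  ∣E∣⁺≤∣D∣⁺ : ∣E∣⁺ ≤ ∣D∣⁺
  ∣E∣⁺≤∣D∣⁺ = ∣D∩X∣≤∣D∣ (d ∷ D) (c ∷ e)

  k+∣E∣⁺≤∣D∣⁺ : k + ∣E∣⁺ ≤ ∣D∣⁺
  k+∣E∣⁺≤∣D∣⁺ = subst (k + ∣E∣⁺ ≤_) (m∸n+n≡m ∣E∣⁺≤∣D∣⁺) (+-monoˡ-≤ ∣E∣⁺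
    (m≤n+o⇒m∸n≤o (suc a) b (+-cancelʳ-≤ ∣E∣⁺ _ _ (≤-trans bound (≤-reflexive
      (trans (cong (b +_) (sym (m∸n+n≡m ∣E∣⁺≤∣D∣⁺))) (sym (+-assoc b _ ∣E∣⁺))))))))

  ∣E∩K∣⁺+k : ∣ ((d ∷ D) ∩ (c ∷ e)) ∩ (true ∷ K) ∣ + k ≡ ∣E∣⁺
  ∣E∩K∣⁺+k = with-head (d ∧ c)
    where
    with-head : ∀ b → ∣ (b ∷ E) ∩ (true ∷ K) ∣ + k ≡ ∣ b ∷ E ∣
    with-head true  = cong suc (proj₁ (proj₂ discarded))
    with-head false = proj₁ (proj₂ discarded)

  size-ok : ∣E∣⁺ + ∣E∣⁺ ≤ ∣D∣⁺ + ∣ ((d ∷ D) ∩ (c ∷ e)) ∩ (true ∷ K) ∣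
  size-ok = subst (λ z → z + ∣E∣⁺ ≤ ∣D∣⁺ + E∩K) ∣E∩K∣⁺+k (≤-trans
    (≤-reflexive (trans (+-assoc E∩K k ∣E∣⁺) (+-comm E∩K (k + ∣E∣⁺)))) (+-monoˡ-≤ E∩K k+∣E∣⁺≤∣D∣⁺))
    where
    E∩K = ∣ ((d ∷ D) ∩ (c ∷ e)) ∩ (true ∷ K) ∣

  weight-ok : ∣ f △ (E ∩ K) ∣ < b
  weight-ok = +-cancelʳ-≤ k _ _ (subst (_≤ b + k) (cong suc (sym (proj₂ (proj₂ discarded)))) (m≤n+m∸n (suc a) b))

-- Sums over the cube and compressions

∑ : (Subset n → ℕ) → ℕ
∑ {zero}  f = f []
∑ {suc n} f = ∑ (f ∘ (false ∷_)) + ∑ (f ∘ (true ∷_))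

Family : ℕ → Set
Family n = Subset n → Bool

size : Family n → ℕ
size F = ∑ (bit ∘ F)

∑-cong : {f g : Subset n → ℕ} → (∀ x → f x ≡ g x) → ∑ f ≡ ∑ g
∑-cong {zero}  h = h []
∑-cong {suc n} h = cong₂ _+_ (∑-cong (h ∘ (false ∷_))) (∑-cong (h ∘ (true ∷_)))

∑-mono : {f g : Subset n → ℕ} → (∀ x → f x ≤ g x) → ∑ f ≤ ∑ g
∑-mono {zero}  h = h []
∑-mono {suc n} h = +-mono-≤ (∑-mono (h ∘ (false ∷_))) (∑-mono (h ∘ (true ∷_)))

∑-mono-< : {f g : Subset n → ℕ} → (∀ x → f x ≤ g x) → ∀ x → f x < g x → ∑ f < ∑ g
∑-mono-< h []          lt = lt
∑-mono-< h (false ∷ x) lt = +-mono-<-≤ (∑-mono-< (h ∘ (false ∷_)) x lt) (∑-mono (h ∘ (true ∷_)))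
∑-mono-< h (true ∷ x)  lt = +-mono-≤-< (∑-mono (h ∘ (false ∷_))) (∑-mono-< (h ∘ (true ∷_)) x lt)

∑-+ : (f g : Subset n → ℕ) → ∑ (λ x → f x + g x) ≡ ∑ f + ∑ g
∑-+ {zero}  f g = refl
∑-+ {suc n} f g = trans (cong₂ _+_ (∑-+ (f ∘ (false ∷_)) _) (∑-+ (f ∘ (true ∷_)) _))
  (interchange +-commutativeSemigroup (∑ (f ∘ (false ∷_))) (∑ (g ∘ (false ∷_))) (∑ (f ∘ (true ∷_))) (∑ (g ∘ (true ∷_))))

∑-const : ∀ n c → ∑ {n} (λ _ → c) ≡ 2 ^ n * c
∑-const zero    c = sym (+-identityʳ c)
∑-const (suc n) c = trans (cong₂ _+_ (∑-const n c) (∑-const n c)) (double (2 ^ n) c)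
  where
  double : ∀ a c → a * c + a * c ≡ (2 * a) * c
  double = solve-∀

∑-△ : (f : Subset n → ℕ) (D : Subset n) → ∑ (λ x → f (x △ D)) ≡ ∑ f
∑-△ f []          = refl
∑-△ f (false ∷ D) = cong₂ _+_ (∑-△ (f ∘ (false ∷_)) D) (∑-△ (f ∘ (true ∷_)) D)
∑-△ f (true ∷ D)  = trans (cong₂ _+_ (∑-△ (f ∘ (true ∷_)) D) (∑-△ (f ∘ (false ∷_)) D))
  (+-comm (∑ (f ∘ (true ∷_))) _)

-- Each pair `x`, `x △ D` is counted twice, so claims about sums can be checked pair by pair and
-- then halved.
∑-pairs : (f : Subset n → ℕ) (D : Subset n) → ∑ (λ x → f x + f (x △ D)) ≡ ∑ f + ∑ f
∑-pairs f D = trans (∑-+ f _) (cong (∑ f +_) (∑-△ f D))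

m+m≡m*2 : ∀ m → m + m ≡ m * 2
m+m≡m*2 = solve-∀

m+m-injective : ∀ {a b} → a + a ≡ b + b → a ≡ b
m+m-injective {a} {b} eq with <-cmp a b
... | tri< lt _ _ = contradiction eq (<⇒≢ (+-mono-< lt lt))
... | tri≈ _ e _  = e
... | tri> _ _ gt = contradiction (sym eq) (<⇒≢ (+-mono-< gt gt))

m+m-cancel-< : ∀ {a b} → a + a < b + b → a < b
m+m-cancel-< {a} {b} lt with a <? b
... | yes p = p
... | no ¬p = contradiction lt (≤⇒≯ (+-mono-≤ (≮⇒≥ ¬p) (≮⇒≥ ¬p)))

m+m-cancel-≤ : ∀ {a b} → a + a ≤ b + b → a ≤ b
m+m-cancel-≤ {a} {b} le with a ≤? b
... | yes p = p
... | no ¬p = contradiction le (<⇒≱ (+-mono-< (≰⇒> ¬p) (≰⇒> ¬p)))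

-- u and v stand for membership of x and of x △ D, and a and b for wt (x △ D) and wt x.
merge : ∀ {a b} → Tri (a < b) (a ≡ b) (b < a) → Bool → Bool → Bool
merge (tri< _ _ _) u v = u ∧ v
merge (tri≈ _ _ _) u v = u
merge (tri> _ _ _) u v = u ∨ v

merge-size : ∀ a b u v →
  bit (merge (<-cmp a b) u v) + bit (merge (<-cmp b a) v u) ≡ bit u + bit v
merge-size a b u v with <-cmp a b | <-cmp b a
... | tri< lt _ _ | tri< gt _ _ = contradiction gt (<-asym lt)
... | tri< _ ne _ | tri≈ _ e _  = contradiction (sym e) ne
... | tri≈ _ e _  | tri< _ ne _ = contradiction (sym e) ne
... | tri≈ _ _ _  | tri≈ _ _ _  = refl
... | tri≈ _ e _  | tri> _ ne _ = contradiction (sym e) ne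
... | tri> _ ne _ | tri≈ _ e _  = contradiction (sym e) ne
... | tri> _ _ lt | tri> _ _ gt = contradiction gt (<-asym lt)
... | tri< _ _ _  | tri> _ _ _  = lemma u v
  where
  lemma : ∀ u v → bit (u ∧ v) + bit (v ∨ u) ≡ bit u + bit v
  lemma true  true  = refl
  lemma true  false = refl
  lemma false true  = refl
  lemma false false = refl
... | tri> _ _ _  | tri< _ _ _  = lemma u v
  where
  lemma : ∀ u v → bit (u ∨ v) + bit (v ∧ u) ≡ bit u + bit v
  lemma true  true  = refl
  lemma true  false = refl
  lemma false true  = refl
  lemma false false = refl

merge-weight : ∀ a b u v →
  bit (merge (<-cmp a b) u v) * b + bit (merge (<-cmp b a) v u) * a ≤ bit u * b + bit v * a
merge-weight a b u v with <-cmp a b | <-cmp b a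
... | tri< lt _ _ | tri< gt _ _ = contradiction gt (<-asym lt)
... | tri< _ ne _ | tri≈ _ e _  = contradiction (sym e) ne
... | tri≈ _ e _  | tri< _ ne _ = contradiction (sym e) ne
... | tri≈ _ _ _  | tri≈ _ _ _  = ≤-refl
... | tri≈ _ e _  | tri> _ ne _ = contradiction (sym e) ne
... | tri> _ ne _ | tri≈ _ e _  = contradiction (sym e) ne
... | tri> _ _ lt | tri> _ _ gt = contradiction gt (<-asym lt)
... | tri< lt _ _  | tri> _ _ _  = lemma u v
  where
  lemma : ∀ u v → bit (u ∧ v) * b + bit (v ∨ u) * a ≤ bit u * b + bit v * a
  lemma true  true  = ≤-refl
  lemma true  false = subst₂ _≤_ (sym (+-identityʳ a)) (sym (trans (+-identityʳ _) (+-identityʳ b))) (<⇒≤ lt)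
  lemma false true  = ≤-refl
  lemma false false = ≤-refl
... | tri> _ _ lt  | tri< _ _ _  = lemma u v
  where
  lemma : ∀ u v → bit (u ∨ v) * b + bit (v ∧ u) * a ≤ bit u * b + bit v * a
  lemma true  true  = ≤-refl
  lemma true  false = ≤-refl
  lemma false true  = subst₂ _≤_ (sym (trans (+-identityʳ _) (+-identityʳ b))) (sym (+-identityʳ a)) (<⇒≤ lt)
  lemma false false = ≤-refl

merge-weight-< : ∀ a b → a < b →
  bit (merge (<-cmp a b) true false) * b + bit (merge (<-cmp b a) false true) * a < 1 * b + 0 * a
merge-weight-< a b lt with <-cmp a b | <-cmp b a
... | tri< _ _ _  | tri> _ _ _  = subst₂ _<_ (sym (+-identityʳ a)) (sym (trans (+-identityʳ _) (+-identityʳ b))) lt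
... | tri≈ ¬lt _ _ | _           = contradiction lt ¬lt
... | tri> ¬lt _ _ | _           = contradiction lt ¬lt
... | tri< _ _ _  | tri< gt _ _ = contradiction gt (<-asym lt)
... | tri< _ ne _ | tri≈ _ e _  = contradiction (sym e) ne

-- The down-compression along `D`: of the two vertices in a pair, the heavier survives only if both
-- belong to `F`, and the lighter enters as soon as one does.
compress : Subset (suc n) → Family (suc n) → Family (suc n)
compress D F x = merge (<-cmp (wt (x △ D)) (wt x)) (F x) (F (x △ D))

compress-△ : (D : Subset (suc n)) (F : Family (suc n)) (x : Subset (suc n)) →
  compress D F (x △ D) ≡ merge (<-cmp (wt x) (wt (x △ D))) (F (x △ D)) (F x)
compress-△ D F x rewrite [x△y]△y≡x x D = refl

compress-size : (D : Subset (suc n)) (F : Family (suc n)) → size (compress D F) ≡ size F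
compress-size D F = m+m-injective (begin
  size (compress D F) + size (compress D F)                         ≡⟨ ∑-pairs (bit ∘ compress D F) D ⟨
  ∑ (λ x → bit (compress D F x) + bit (compress D F (x △ D)))       ≡⟨ ∑-cong (λ x →
    trans (cong (λ z → bit (compress D F x) + bit z) (compress-△ D F x))
      (merge-size (wt (x △ D)) (wt x) (F x) (F (x △ D)))) ⟩
  ∑ (λ x → bit (F x) + bit (F (x △ D)))                             ≡⟨ ∑-pairs (bit ∘ F) D ⟩
  size F + size F                                                   ∎)
  where open ≡-Reasoning

weight : Family (suc n) → ℕ
weight F = ∑ (λ x → bit (F x) * wt x)

module _ (D : Subset (suc n)) (F : Family (suc n)) where
  private
    g f : Subset (suc n) → ℕ
    g x = bit (compress D F x) * wt x
    f x = bit (F x) * wt x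

    pointwise : ∀ x → g x + g (x △ D) ≤ f x + f (x △ D)
    pointwise x = subst (λ z → g x + bit z * wt (x △ D) ≤ f x + f (x △ D)) (sym (compress-△ D F x))
      (merge-weight (wt (x △ D)) (wt x) (F x) (F (x △ D)))

  compress-weight : weight (compress D F) ≤ weight F
  compress-weight = m+m-cancel-≤ (subst₂ _≤_ (∑-pairs g D) (∑-pairs f D) (∑-mono pointwise))

  compress-weight-< : ∀ x → F x ≡ true → wt (x △ D) < wt x → F (x △ D) ≡ false →
    weight (compress D F) < weight F
  compress-weight-< x p lt q = m+m-cancel-< (subst₂ _<_ (∑-pairs g D) (∑-pairs f D)
    (∑-mono-< pointwise x strict))
    where
    strict : g x + g (x △ D) < f x + f (x △ D)
    strict rewrite compress-△ D F x | p | q = merge-weight-< (wt (x △ D)) (wt x) lt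

  -- The origin of a member: it either stayed, which a lighter partner permits only by being present
  -- as well, or came from its heavier partner.
  compress-∈ : ∀ x → compress D F x ≡ true →
    (F x ≡ true × (wt (x △ D) < wt x → F (x △ D) ≡ true)) ⊎
    (wt x < wt (x △ D) × F (x △ D) ≡ true)
  compress-∈ x p with <-cmp (wt (x △ D)) (wt x) | F x | F (x △ D)
  compress-∈ x p | tri< _ _ _    | true  | true  = inj₁ (refl , λ _ → refl)
  compress-∈ x p | tri≈ ¬lt _ _  | true  | _     = inj₁ (refl , λ lt → contradiction lt ¬lt)
  compress-∈ x p | tri> ¬lt _ _  | true  | _     = inj₁ (refl , λ lt → contradiction lt ¬lt)
  compress-∈ x p | tri> _ _ gt   | false | true  = inj₂ (gt , refl)

-- Stability, and simultaneous compression of two families.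

Stable : Subset (suc n) → Family (suc n) → Set
Stable D F = ∀ x → F x ≡ true → wt (x △ D) < wt x → F (x △ D) ≡ true

Unstable : Subset (suc n) → Family (suc n) → Set
Unstable D F = ∃ λ x → (F x ≡ true) × (wt (x △ D) < wt x) × (F (x △ D) ≡ false)

unstable? : (D : Subset (suc n)) (F : Family (suc n)) → Dec (Unstable D F)
unstable? D F = anySubset? λ x →
  (F x Bool.≟ true) ×-dec (wt (x △ D) <? wt x) ×-dec (F (x △ D) Bool.≟ false)

¬unstable⇒stable : (D : Subset (suc n)) (F : Family (suc n)) → ¬ Unstable D F → Stable D F
¬unstable⇒stable D F ¬u x p lt with F (x △ D) in eq
... | true  = refl
... | false = contradiction (x , p , lt , eq) ¬u

Cross : ℕ → Family n → Family n → Set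
Cross p F G = ∀ x y → F x ≡ true → G y ≡ true → ∣ x △ y ∣ ≤ p

Cross-sym : ∀ {p} {F G : Family n} → Cross p F G → Cross p G F
Cross-sym h x y Gx Fy = subst (λ z → ∣ z ∣ ≤ _) (△-comm y x) (h y x Fy Gx)

-- If moving f alone creates too large a distance, then f and g agree on more than half of D;
-- flipping a suitable part of that agreement set in g instead gives a member of G
-- which is already at least as far from f.
cross-moved-fixed : ∀ p (f g D : Subset (suc n)) (G : Family (suc n)) →
  (∀ y → G y ≡ true → ∣ f △ y ∣ ≤ p) →
  (∀ D′ → ∣ D′ ∣ < ∣ D ∣ → Stable D′ G) →
  wt (f △ D) < wt f → G g ≡ true → (wt (g △ D) < wt g → G (g △ D) ≡ true) →
  ∣ (f △ D) △ g ∣ ≤ p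
cross-moved-fixed p f g D G near stable lt Gg fixed with wt (g △ D) <? wt g
... | yes lt′ = subst (λ z → ∣ z ∣ ≤ p)
        (trans (sym (△-assoc f g D)) ([x△y]△z≡[x△z]△y f g D)) (near (g △ D) (fixed lt′))
... | no ¬lt′ with ∣ D ∣ <? ∣ D ∩ ((f △ D) △ g) ∣ + ∣ D ∩ ((f △ D) △ g) ∣
-- Here `e` covers at most half of `D`, so passing from `e` to `e △ D`, which is `f △ g`, does not
-- decrease the size.
...   | no ¬big = ≤-trans (+-cancelʳ-≤ (∣ D ∣) _ _ near-D)
          (subst (λ z → ∣ z ∣ ≤ p) (sym ([[x△z]△y]△z≡x△y f g D)) (near g Gg))
  where
  e = (f △ D) △ g
  near-D : ∣ e ∣ + ∣ D ∣ ≤ ∣ e △ D ∣ + ∣ D ∣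
  near-D = begin
    ∣ e ∣ + ∣ D ∣                          ≡⟨ ∣e△D∣+2∣D∩e∣ e D ⟨
    ∣ e △ D ∣ + (∣ D ∩ e ∣ + ∣ D ∩ e ∣)    ≤⟨ +-monoʳ-≤ (∣ e △ D ∣) (≮⇒≥ ¬big) ⟩
    ∣ e △ D ∣ + ∣ D ∣                      ∎
    where open ≤-Reasoning
...   | yes big = ≤-trans (+-cancelʳ-≤ (∣ D ∣) _ _ far) (subst (_≤ p) ∣f△g₁∣ (near (g △ M) (stable M M<D g Gg lt-g)))
  where
  e = (f △ D) △ g
  shrunk = shrink f D e lt big
  K = proj₁ shrunk
  M = D ∩ (e ∩ K)
  M≡ : (D ∩ e) ∩ K ≡ M
  M≡ = ∩-assoc D e K
  lt-g : wt (g △ M) < wt g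
  lt-g = +-cancelʳ-< (wt f) _ _ (subst₂ _<_ (sym (wt-△-agree f g D K)) (+-comm (wt f) (wt g))
    (+-monoˡ-< (wt g) (subst (λ z → wt (f △ z) < wt f) M≡ (proj₂ (proj₂ shrunk)))))
  -- If `M` were all of `D`, then `lt-g` would contradict `¬lt′`; so stability under smaller flips
  -- applies to `M`.
  M<D : ∣ M ∣ < ∣ D ∣
  M<D with ∣D∩X∣<∣D∣⊎≡ D (e ∩ K)
  ... | inj₁ m<d = m<d
  ... | inj₂ m≡d = contradiction (subst (λ z → wt (g △ z) < wt g) m≡d lt-g) ¬lt′
  ∣f△g₁∣ : ∣ f △ (g △ M) ∣ ≡ ∣ e △ D ∣ + ∣ M ∣
  ∣f△g₁∣ = trans (cong ∣_∣ (trans (sym (△-assoc f g M)) (cong (_△ M) (sym ([[x△z]△y]△z≡x△y f g D)))))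
    (∣[e△D]△[D∩[e∩K]]∣ e D K)
  far : ∣ e ∣ + ∣ D ∣ ≤ (∣ e △ D ∣ + ∣ M ∣) + ∣ D ∣
  far = begin
    ∣ e ∣ + ∣ D ∣                               ≡⟨ ∣e△D∣+2∣D∩e∣ e D ⟨
    ∣ e △ D ∣ + (∣ D ∩ e ∣ + ∣ D ∩ e ∣)         ≤⟨ +-monoʳ-≤ (∣ e △ D ∣) (proj₁ (proj₂ shrunk)) ⟩
    ∣ e △ D ∣ + (∣ D ∣ + ∣ (D ∩ e) ∩ K ∣)       ≡⟨ cong (λ z → ∣ e △ D ∣ + (∣ D ∣ + ∣ z ∣)) M≡ ⟩
    ∣ e △ D ∣ + (∣ D ∣ + ∣ M ∣)                 ≡⟨ cong (∣ e △ D ∣ +_) (+-comm (∣ D ∣) (∣ M ∣)) ⟩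
    ∣ e △ D ∣ + (∣ M ∣ + ∣ D ∣)                 ≡⟨ +-assoc (∣ e △ D ∣) (∣ M ∣) (∣ D ∣) ⟨
    (∣ e △ D ∣ + ∣ M ∣) + ∣ D ∣                 ∎
    where open ≤-Reasoning

-- If both points stayed or both moved, their distance already occurred between `F` and `G`. If only
-- one moved, stability under smaller flips enters through `cross-moved-fixed`.
compress-cross : ∀ {p} (D : Subset (suc n)) (F G : Family (suc n)) →
  (∀ D′ → ∣ D′ ∣ < ∣ D ∣ → Stable D′ F × Stable D′ G) →
  Cross p F G → Cross p (compress D F) (compress D G)
compress-cross {p = p} D F G stable cross x y Cx Cy with compress-∈ D F x Cx | compress-∈ D G y Cy
... | inj₁ (Fx , _) | inj₁ (Gy , _) = cross x y Fx Gy
... | inj₂ (_ , Fx) | inj₂ (_ , Gy) =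
  subst (λ z → ∣ z ∣ ≤ p) ([x△z]△[y△z]≡x△y x y D) (cross (x △ D) (y △ D) Fx Gy)
... | inj₂ (lt , Fx) | inj₁ (Gy , fixed) =
  subst (λ z → ∣ z △ y ∣ ≤ p) ([x△y]△y≡x x D)
    (cross-moved-fixed p (x △ D) y D G (λ z → cross (x △ D) z Fx) (λ D′ s → proj₂ (stable D′ s))
      (subst (λ z → wt z < wt (x △ D)) (sym ([x△y]△y≡x x D)) lt) Gy fixed)
... | inj₁ (Fx , fixed) | inj₂ (lt , Gy) =
  subst (λ z → ∣ z ∣ ≤ p) (trans (cong (_△ x) ([x△y]△y≡x y D)) (△-comm y x))
    (cross-moved-fixed p (y △ D) x D F (λ z → Cross-sym {F = F} {G} cross (y △ D) z Gy)
      (λ D′ s → proj₁ (stable D′ s))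
      (subst (λ z → wt z < wt (y △ D)) (sym ([x△y]△y≡x y D)) lt) Fx fixed)

smallest : {P : Subset n → Set} → (∀ D → Dec (P D)) → ∀ D → P D → Acc _<_ (∣ D ∣) →
  ∃ λ D → P D × (∀ D′ → ∣ D′ ∣ < ∣ D ∣ → ¬ P D′)
smallest P? D p (acc rs) with anySubset? (λ D′ → (∣ D′ ∣ <? ∣ D ∣) ×-dec P? D′)
... | yes (D′ , lt , p′) = smallest P? D′ p′ (rs lt)
... | no ¬smaller = D , p , λ D′ lt p′ → ¬smaller (D′ , lt , p′)

-- Recursion on the total weight. A smallest `D` with an instability supplies the hypothesis of
-- `compress-cross`, and compressing along it strictly lowers the weight of an unstable family
-- without raising that of the other.
stabilise : ∀ {p} (F G : Family (suc n)) → Cross p F G → Acc _<_ (weight F + weight G) →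
  Σ (Family (suc n)) λ F′ → Σ (Family (suc n)) λ G′ → Cross p F′ G′ ×
    (size F′ ≡ size F) × (size G′ ≡ size G) × (∀ D → Stable D F′) × (∀ D → Stable D G′)
stabilise {n} F G cross (acc rs) with anySubset? (λ D → unstable? D F ⊎-dec unstable? D G)
... | no ¬u = F , G , cross , refl , refl ,
        (λ D → ¬unstable⇒stable D F (λ u → ¬u (D , inj₁ u))) ,
        (λ D → ¬unstable⇒stable D G (λ u → ¬u (D , inj₂ u)))
... | yes (D₀ , u₀) with smallest (λ D → unstable? D F ⊎-dec unstable? D G) D₀ u₀ (<-wellFounded _)
...   | D , u , min with stabilise (compress D F) (compress D G)
                          (compress-cross D F G below cross) (rs (lighter u))
  where
  below : ∀ D′ → ∣ D′ ∣ < ∣ D ∣ → Stable D′ F × Stable D′ G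
  below D′ lt = ¬unstable⇒stable D′ F (λ u → min D′ lt (inj₁ u)) ,
    ¬unstable⇒stable D′ G (λ u → min D′ lt (inj₂ u))
  lighter : Unstable D F ⊎ Unstable D G →
    weight (compress D F) + weight (compress D G) < weight F + weight G
  lighter (inj₁ (x , p , lt , q)) = +-mono-<-≤ (compress-weight-< D F x p lt q) (compress-weight D G)
  lighter (inj₂ (x , p , lt , q)) = +-mono-≤-< (compress-weight D F) (compress-weight-< D G x p lt q)
...     | F′ , G′ , cross′ , sF , sG , stF , stG =
  F′ , G′ , cross′ , trans sF (compress-size D F) , trans sG (compress-size D G) , stF , stG

-- Every `y` arises from `x` by the single flip `x △ y`.
stable⇒downward : (F : Family (suc n)) → (∀ D → Stable D F) →
  ∀ x y → F x ≡ true → wt y < wt x → F y ≡ true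
stable⇒downward F stable x y Fx lt = subst (λ z → F z ≡ true) (x△[x△y]≡y x y)
  (stable (x △ y) x Fx (subst (λ z → wt z < wt x) (sym (x△[x△y]≡y x y)) lt))

-- Binomial sums as sizes of balls

ball : ∀ n → ℕ → Family n
ball n t x = ∣ x ∣ <ᵇ suc t

ball-∈ : ∀ {t} (x : Subset n) → ∣ x ∣ ≤ t → ball n t x ≡ true
ball-∈ x le = Equivalence.to T-≡ (<⇒<ᵇ (s≤s le))

ball-∋ : ∀ {t} (x : Subset n) → ball n t x ≡ true → ∣ x ∣ ≤ t
ball-∋ {t = t} x eq = ≤-pred (<ᵇ⇒< (∣ x ∣) (suc t) (Equivalence.from T-≡ eq))

sumTo-C-pascal : ∀ n t → sumTo (suc t) (suc n C_) ≡ sumTo (suc t) (n C_) + sumTo t (n C_)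
sumTo-C-pascal n zero    = trans (cong₂ _+_ {x = 1} refl (sym (nCk+nC[k+1]≡[n+1]C[k+1] n 0)))
  (swap (n C 0) (n C 1))
  where
  swap : ∀ a b → 1 + (a + b) ≡ 1 + b + a
  swap = solve-∀
sumTo-C-pascal n (suc t) = trans (cong₂ _+_ (sumTo-C-pascal n t) (sym (nCk+nC[k+1]≡[n+1]C[k+1] n (suc t))))
  (regroup (sumTo (suc t) (n C_)) (sumTo t (n C_)) (n C suc t) (n C suc (suc t)))
  where
  regroup : ∀ a b c d → (a + b) + (c + d) ≡ (a + d) + (b + c)
  regroup = solve-∀

size-ball : ∀ n t → size (ball n t) ≡ sumTo t (n C_)
size-ball zero    zero    = refl
size-ball zero    (suc t) = trans (size-ball zero t) (sym (+-identityʳ _))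
size-ball (suc n) zero    = trans (cong₂ _+_ (size-ball n 0) (∑-const n 0)) (cong (1 +_) (*-zeroʳ (2 ^ n)))
size-ball (suc n) (suc t) = trans (cong₂ _+_ (size-ball n (suc t)) (size-ball n t)) (sym (sumTo-C-pascal n t))

∣x△⊤∣ : (x : Subset n) → ∣ x △ ⊤ ∣ + ∣ x ∣ ≡ n
∣x△⊤∣ []          = refl
∣x△⊤∣ (true ∷ x)  = trans (+-suc _ _) (cong suc (∣x△⊤∣ x))
∣x△⊤∣ (false ∷ x) = cong suc (∣x△⊤∣ x)

-- A set and its complement in `2m + 1` points cannot both have at most `m` elements, so the ball
-- meets each complementary pair at most once.
size-half-ball : ∀ m → let N = suc (m * 2) in size (ball N m) + size (ball N m) ≤ 2 ^ N
size-half-ball m = subst₂ _≤_ (∑-pairs (bit ∘ ball N m) ⊤) (trans (∑-const N 1) (*-identityʳ _))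
  (∑-mono disjoint)
  where
  N = suc (m * 2)
  disjoint : (x : Subset N) → bit (ball N m x) + bit (ball N m (x △ ⊤)) ≤ 1
  disjoint x with ball N m x in eq | ball N m (x △ ⊤) in eq′
  ... | true  | true  = contradiction (+-mono-≤ (ball-∋ (x △ ⊤) eq′) (ball-∋ x eq))
    (<⇒≱ (subst (m + m <_) (sym (∣x△⊤∣ x)) (s≤s (≤-reflexive (m+m≡m*2 m)))))
  ... | true  | false = ≤-refl
  ... | false | true  = ≤-refl
  ... | false | false = z≤n

-- Far points and large families at bounded distance.

∃-larger : {F G : Family n} → size G < size F → ∃ λ x → F x ≡ true × G x ≡ false
∃-larger {F = F} {G} lt with anySubset? (λ x → (F x Bool.≟ true) ×-dec (G x Bool.≟ false))
... | yes found = found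
... | no ¬found = contradiction lt (≤⇒≯ (∑-mono included))
  where
  included : ∀ x → bit (F x) ≤ bit (G x)
  included x with F x in p | G x in q
  ... | true  | true  = ≤-refl
  ... | true  | false = contradiction (x , p , q) ¬found
  ... | false | _     = z≤n

-- The two equations together say that `y` is disjoint from `x` and fills it up to `q` elements.
extend-to : (x : Subset n) → ∀ q → ∣ x ∣ ≤ q → q ≤ n → ∃ λ y → (∣ x △ y ∣ ≡ q) × (∣ x ∣ + ∣ y ∣ ≡ q)
extend-to [] zero _ _ = [] , refl , refl
extend-to (true ∷ x) (suc q) (s≤s le) (s≤s le′) with extend-to x q le le′
... | y , e , e′ = false ∷ y , cong suc e , cong suc e′
-- A coordinate outside `x` is skipped while the remaining ones can still hold `q` elements;
-- otherwise `q` is `suc n` and it must be taken.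
extend-to {suc n} (false ∷ x) q le le′ with q ≤? n
... | yes q≤n with extend-to x q le q≤n
...   | y , e , e′ = false ∷ y , e , e′
extend-to {suc n} (false ∷ x) zero le le′ | no q≰n = contradiction z≤n q≰n
extend-to {suc n} (false ∷ x) (suc q) le (s≤s le′) | no q≰n
  with extend-to x q (≤-trans (∣p∣≤n x) (≤-pred (≰⇒> q≰n))) le′
... | y , e , e′ = true ∷ y , cong suc e , trans (+-suc _ _) (cong suc e′)

-- If `x` has at most `suc m + t` elements, fill it up to that size by a disjoint `y`; as `x` has
-- more than `m` elements, `y` needs at most `t`. A larger `x` is already far from the empty set.
far-point : ∀ t (x : Subset n) → ∀ m → m < ∣ x ∣ → suc m + t ≤ n → ∃ λ y → ∣ y ∣ ≤ t × suc m + t ≤ ∣ x △ y ∣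
far-point t x m lt le with ∣ x ∣ ≤? suc m + t
... | yes x≤ with extend-to x (suc m + t) x≤ le
...   | y , e , e′ = y , +-cancelˡ-≤ (suc m) _ _ (≤-trans (+-monoˡ-≤ (∣ y ∣) lt) (≤-reflexive e′))
      , ≤-reflexive (sym e)
far-point {n} t x m lt le | no x≰ =
  FS.⊥ , subst (_≤ t) (sym (∣⊥∣≡0 n)) z≤n ,
  subst (λ z → suc m + t ≤ ∣ z ∣) (sym (x△⊥≡x x)) (<⇒≤ (≰⇒> x≰))
  where
  x△⊥≡x : ∀ {n} (x : Subset n) → x △ FS.⊥ ≡ x
  x△⊥≡x []          = refl
  x△⊥≡x (true ∷ x)  = cong (true ∷_) (x△⊥≡x x)
  x△⊥≡x (false ∷ x) = cong (false ∷_) (x△⊥≡x x)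

-- If `y` were missing, downward closure would keep every member of `G` at weight at most `wt y`.
-- Then `G` would lie strictly inside the set of vertices of weight at most `t`, whose size is twice
-- that of the ball because the first coordinate is free.
stable-⊇ball : ∀ t (G : Family (suc n)) → (∀ D → Stable D G) →
  size (ball n t) + size (ball n t) ≤ size G → ∀ y → wt y ≤ t → G y ≡ true
stable-⊇ball {n} t G stable large y y≤t with G y in Gy
... | true  = refl
... | false = contradiction large (<⇒≱ (∑-mono-< included y strict))
  where
  included : ∀ x → bit (G x) ≤ bit (ball n t (tail x))
  included (h ∷ x) with G (h ∷ x) in Gx
  ... | false = z≤n
  ... | true with wt y <? ∣ x ∣
  ...   | yes lt = contradiction (trans (sym (stable⇒downward G stable (h ∷ x) y Gx lt)) Gy) λ ()
  ...   | no ¬lt = ≤-reflexive (sym (cong bit (ball-∈ x (≤-trans (≮⇒≥ ¬lt) y≤t))))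
  strict : bit (G y) < bit (ball n t (tail y))
  strict rewrite Gy | ball-∈ (tail y) y≤t = ≤-refl

-- `2 ^ N` is half of the cube and bounds the number of vertices of weight at most `m`, so the
-- stabilised `F` has a member of weight above `m`, while the stabilised `G` contains every vertex
-- of weight at most `t`.
no-large-cross : ∀ m t → t ≤ m → let N = suc (m * 2) in (F G : Family (suc N)) →
  Cross (suc m + t) F G → 2 ^ N < size F → sumTo t (N C_) + sumTo t (N C_) ≤ size G → ⊥
no-large-cross m t t≤m F G cross largeF largeG
  with stabilise F G cross (<-wellFounded _)
... | F′ , G′ , cross′ , sF , sG , stF , stG
  with ∃-larger {F = F′} {G = λ x → ball (suc (m * 2)) m (tail x)}
         (≤-<-trans (size-half-ball m) (subst (2 ^ suc (m * 2) <_) (sym sF) largeF))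
... | h ∷ x , Fx , x∉ball
  with far-point t x m (≰⇒> λ le → contradiction (trans (sym (ball-∈ x le)) x∉ball) λ ())
         (s≤s (≤-trans (+-monoʳ-≤ m t≤m) (≤-reflexive (m+m≡m*2 m))))
-- The weight leaves the first coordinate of the second point free; choosing it opposite to `h` adds
-- the one unit by which the distance exceeds `suc m + t`.
... | y , y≤t , far = contradiction (cross′ (h ∷ x) (not h ∷ y) Fx Gy) (<⇒≱ (flip-head h))
  where
  Gy : G′ (not h ∷ y) ≡ true
  Gy = stable-⊇ball t G′ stG
    (subst₂ _≤_ (sym (cong₂ _+_ (size-ball _ t) (size-ball _ t))) (sym sG) largeG) (not h ∷ y) y≤t
  flip-head : ∀ h → suc m + t < ∣ (h ∷ x) △ (not h ∷ y) ∣
  flip-head true  = s≤s far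
  flip-head false = s≤s far

-- b-colourings

∑-≥ : (f : Subset n → ℕ) → ∀ x → f x ≤ ∑ f
∑-≥ f []          = ≤-refl
∑-≥ f (false ∷ x) = ≤-trans (∑-≥ (f ∘ (false ∷_)) x) (m≤m+n _ _)
∑-≥ f (true ∷ x)  = ≤-trans (∑-≥ (f ∘ (true ∷_)) x) (m≤n+m _ _)

∑-≥₂ : (f : Subset n → ℕ) → ∀ x y → x ≢ y → f x + f y ≤ ∑ f
∑-≥₂ f [] [] ne = contradiction refl ne
∑-≥₂ f (false ∷ x) (false ∷ y) ne = ≤-trans (∑-≥₂ (f ∘ (false ∷_)) x y (ne ∘ cong (false ∷_))) (m≤m+n _ _)
∑-≥₂ f (true ∷ x)  (true ∷ y)  ne = ≤-trans (∑-≥₂ (f ∘ (true ∷_)) x y (ne ∘ cong (true ∷_))) (m≤n+m _ _)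
∑-≥₂ f (false ∷ x) (true ∷ y)  ne = +-mono-≤ (∑-≥ (f ∘ (false ∷_)) x) (∑-≥ (f ∘ (true ∷_)) y)
∑-≥₂ f (true ∷ x)  (false ∷ y) ne = ≤-trans (≤-reflexive (+-comm (f (true ∷ x)) _))
  (+-mono-≤ (∑-≥ (f ∘ (false ∷_)) y) (∑-≥ (f ∘ (true ∷_)) x))

∑-by-colour : (κ h : Subset n → ℕ) → ∀ a j →
  (∀ i → i < j → a ≤ ∑ (λ x → bit (κ x ≡ᵇ i) * h x)) →
  j * a ≤ ∑ (λ x → bit (κ x <ᵇ j) * h x)
∑-by-colour κ h a zero    hyp = z≤n
∑-by-colour κ h a (suc j) hyp = begin
  a + j * a                                                                   ≤⟨ +-mono-≤ (hyp j ≤-refl)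
    (∑-by-colour κ h a j (λ i lt → hyp i (m≤n⇒m≤1+n lt))) ⟩
  ∑ (λ x → bit (κ x ≡ᵇ j) * h x) + ∑ (λ x → bit (κ x <ᵇ j) * h x)             ≡⟨ ∑-+ (λ x → bit (κ x ≡ᵇ j) * h x)
    (λ x → bit (κ x <ᵇ j) * h x) ⟨
  ∑ (λ x → bit (κ x ≡ᵇ j) * h x + bit (κ x <ᵇ j) * h x)                       ≡⟨ ∑-cong (λ x →
    trans (sym (*-distribʳ-+ (h x) (bit (κ x ≡ᵇ j)) _)) (cong (_* h x) (split (κ x) j))) ⟩
  ∑ (λ x → bit (κ x <ᵇ suc j) * h x)                                          ∎
  where
  open ≤-Reasoning
  split : ∀ a j → bit (a ≡ᵇ j) + bit (a <ᵇ j) ≡ bit (a <ᵇ suc j)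
  split zero    zero    = refl
  split zero    (suc j) = refl
  split (suc a) zero    = refl
  split (suc a) (suc j) = split a j

-- Double counting over the colour classes; colours are compared as natural numbers so that
-- `∑-by-colour` can add one class at a time.
∑-colour-classes : ∀ {k} (c : Subset n → Fin k) (h : Subset n → ℕ) a →
  (∀ i → a ≤ ∑ (λ x → bit (toℕ (c x) ≡ᵇ toℕ i) * h x)) → k * a ≤ ∑ h
∑-colour-classes {k = k} c h a hyp = ≤-trans
  (∑-by-colour (toℕ ∘ c) h a k (λ i lt → subst (λ z → a ≤ ∑ (λ x → bit (toℕ (c x) ≡ᵇ z) * h x))
    (toℕ-fromℕ< lt) (hyp (fromℕ< lt))))
  (∑-mono (λ x → bit*≤ (toℕ (c x) <ᵇ k) (h x)))
  where
  bit*≤ : ∀ b m → bit b * m ≤ m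
  bit*≤ true  m = ≤-reflexive (+-identityʳ m)
  bit*≤ false m = z≤n

module _ {p k : ℕ} (c : Subset n → Fin k) (isB : IsBColoring (AdjQ n p) k c) where
  private
    _≟ˢ_ : (x y : Subset n) → Dec (x ≡ y)
    _≟ˢ_ = ≡-dec Bool._≟_

    b : Fin k → Subset n
    b i = proj₁ (proj₂ isB i)

    c-b : ∀ i → c (b i) ≡ i
    c-b i = proj₁ (proj₂ (proj₂ isB i))

    twin? : ∀ x → Dec (∃ λ y → c y ≡ c x × y ≢ x)
    twin? x = anySubset? λ y → (c y Fin.≟ c x) ×-dec ¬? (y ≟ˢ x)

  chosen : Family n
  chosen x = does (b (c x) ≟ˢ x)

  alone : Family n
  alone x = not (does (twin? x))

  private
    chosen-∋ : ∀ x → chosen x ≡ true → b (c x) ≡ x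
    chosen-∋ x eq with yes e ← b (c x) ≟ˢ x = e

    alone-∋ : ∀ x → alone x ≡ true → ∀ y → c y ≡ c x → y ≡ x
    alone-∋ x eq y cy with no ¬twin ← twin? x with y ≟ˢ x
    ... | yes e = e
    ... | no ne = contradiction (y , cy , ne) ¬twin

    chosen-b : ∀ i → chosen (b i) ≡ true
    chosen-b i = dec-true (b (c (b i)) ≟ˢ b i) (cong b (c-b i))

    class-term : ∀ i x (h : Subset n → ℕ) → c x ≡ i → bit (toℕ (c x) ≡ᵇ toℕ i) * h x ≡ h x
    class-term i x h refl =
      trans (cong (λ z → bit z * h x) (Equivalence.to T-≡ (≡⇒≡ᵇ (toℕ (c x)) _ refl))) (+-identityʳ (h x))

  -- A b-vertex has a neighbour of every other colour, and in the colour of `y` this can only be `y`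
  -- itself. With equal colours `x` is `y`.
  chosen-cross-alone : Cross p chosen alone
  chosen-cross-alone x y Cx Ay with c y Fin.≟ c x
  ... | yes e = subst (λ z → ∣ x △ z ∣ ≤ p) (alone-∋ y Ay x (sym e)) (subst (_≤ p) (sym (∣x△x∣≡0 x)) z≤n)
  ... | no ne with proj₂ (proj₂ (proj₂ isB (c x))) (c y) ne
  ...   | z , (_ , near) , cz = subst₂ (λ u v → ∣ u △ v ∣ ≤ p) (chosen-∋ x Cx) (alone-∋ y Ay z cz) near

  k≤chosen : k ≤ size chosen
  k≤chosen = subst (_≤ size chosen) (*-identityʳ k) (∑-colour-classes c (bit ∘ chosen) 1 λ i →
    ≤-trans (≤-reflexive (sym (trans (class-term i (b i) (bit ∘ chosen) (c-b i)) (cong bit (chosen-b i)))))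
      (∑-≥ _ (b i)))

  -- Count each vertex once and each lone vertex once more: every class then contributes at least 2,
  -- by two distinct vertices or by one counted twice.
  k*2≤2^n+alone : k * 2 ≤ 2 ^ n + size alone
  k*2≤2^n+alone = ≤-trans (∑-colour-classes c h 2 two)
    (≤-reflexive (trans (∑-+ (λ _ → 1) (bit ∘ alone)) (cong (_+ size alone) (trans (∑-const n 1) (*-identityʳ _)))))
    where
    h : Subset n → ℕ
    h x = 1 + bit (alone x)
    two : ∀ i → 2 ≤ ∑ (λ x → bit (toℕ (c x) ≡ᵇ toℕ i) * h x)
    two i with twin? (b i) in eq
    ... | no _ = ≤-trans (≤-reflexive (sym (trans (class-term i (b i) h (c-b i))
                   (cong (λ z → 1 + bit (not (does z))) eq)))) (∑-≥ _ (b i))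
    ... | yes (y , cy , ne) = ≤-trans (+-mono-≤ (one y (trans cy (c-b i))) (one (b i) (c-b i)))
                   (∑-≥₂ _ y (b i) ne)
      where
      one : ∀ x → c x ≡ i → 1 ≤ bit (toℕ (c x) ≡ᵇ toℕ i) * h x
      one x e = subst (1 ≤_) (sym (class-term i x h e)) (s≤s z≤n)

-- If the bound fails, then `M + ⌈ r /2⌉ ≤ k`. As `r` is positive this gives `M < k`, and doubling
-- it and comparing with the upper bound on `k * 2` gives `r ≤ s`.
bound-colours : ∀ M r {k s} → 1 ≤ r → k * 2 ≤ (M + M) + s → (M < k → r ≤ s → ⊥) →
  k ≤ M + ⌈ r /2⌉ ∸ 1
bound-colours M r {k} {s} 1≤r few no-large with k ≤? M + ⌈ r /2⌉ ∸ 1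
... | yes le = le
... | no ¬le = ⊥-elim (no-large
        (≤-trans (≤-trans (≤-reflexive (+-comm 1 M)) (+-monoʳ-≤ M (⌈n/2⌉-mono 1≤r))) large)
        (+-cancelˡ-≤ (M + M) _ _ (≤-trans 2M+r≤ few)))
  where
  large : M + ⌈ r /2⌉ ≤ k
  large = ≤-trans (m≤n+m∸n _ 1) (≰⇒> ¬le)
  2M+r≤ : (M + M) + r ≤ k * 2
  2M+r≤ = begin
    (M + M) + r                     ≡⟨ cong ((M + M) +_) (⌊n/2⌋+⌈n/2⌉≡n r) ⟨
    (M + M) + (⌊ r /2⌋ + ⌈ r /2⌉)   ≤⟨ +-monoʳ-≤ (M + M) (+-monoˡ-≤ ⌈ r /2⌉ (⌊n/2⌋≤⌈n/2⌉ r)) ⟩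
    (M + M) + (⌈ r /2⌉ + ⌈ r /2⌉)   ≡⟨ double M ⌈ r /2⌉ ⟩
    (M + ⌈ r /2⌉) * 2               ≤⟨ *-monoˡ-≤ 2 large ⟩
    k * 2                           ∎
    where
    open ≤-Reasoning
    double : ∀ a b → (a + a) + (b + b) ≡ (a + b) * 2
    double = solve-∀

-- Odd and even dimension.

1≤sumTo-C : ∀ n t → 1 ≤ sumTo t (n C_)
1≤sumTo-C n zero    = ≤-refl
1≤sumTo-C n (suc t) = ≤-trans (1≤sumTo-C n t) (m≤m+n _ _)

-- An odd cube is lifted to the even cube one dimension higher by ignoring the new coordinate.
bound-odd : ∀ m t → t ≤ m → let N = suc (m * 2) in
  BChromatic≤ (AdjQ N (m + t)) (2 ^ (m * 2) + ⌈ sumTo t (N C_) /2⌉ ∸ 1)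
bound-odd m t t≤m k c isB = bound-colours M r (1≤sumTo-C N t)
  (subst (λ z → k * 2 ≤ (M + z) + size (alone c isB)) (+-identityʳ M) (k*2≤2^n+alone c isB))
  λ M<k r≤s → no-large-cross m t t≤m (chosen c isB ∘ tail) (alone c isB ∘ tail) lifted
    (subst (_< size (chosen c isB ∘ tail)) (cong (M +_) (sym (+-identityʳ M)))
      (+-mono-< (≤-trans M<k (k≤chosen c isB)) (≤-trans M<k (k≤chosen c isB))))
    (+-mono-≤ r≤s r≤s)
  where
  N = suc (m * 2)
  M = 2 ^ (m * 2)
  r = sumTo t (N C_)
  -- The new coordinate contributes at most one to a distance, which turns `m + t` into `suc m + t`;
  -- both sizes double.
  lifted : Cross (suc m + t) (chosen c isB ∘ tail) (alone c isB ∘ tail)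
  lifted (a ∷ x) (b ∷ y) Cx Ay = ≤-trans (∣∷∣≤ (a xor b)) (s≤s (chosen-cross-alone c isB x y Cx Ay))
    where
    ∣∷∣≤ : ∀ h → ∣ h ∷ (x △ y) ∣ ≤ suc (∣ x △ y ∣)
    ∣∷∣≤ true  = ≤-refl
    ∣∷∣≤ false = n≤1+n _

-- By Pascal's rule; this identifies r' with the number of vertices of weight at most `t`, the first
-- coordinate being free.
sumTo-C-double : ∀ n t → sumTo t (suc n C_) + n C t ≡ sumTo t (n C_) + sumTo t (n C_)
sumTo-C-double n zero    = refl
sumTo-C-double n (suc t) = trans (cong (_+ n C suc t) (sumTo-C-pascal n t))
  (+-assoc (sumTo (suc t) (n C_)) (sumTo t (n C_)) (n C suc t))

bound-even : ∀ m t → t ≤ m → let N = suc (m * 2) in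
  BChromatic≤ (AdjQ (suc N) (suc m + t)) (2 ^ N + ⌈ sumTo t (suc N C_) + N C t /2⌉ ∸ 1)
bound-even m t t≤m k c isB = bound-colours M r (≤-trans (1≤sumTo-C (suc N) t) (m≤m+n _ _))
  (subst (λ z → k * 2 ≤ (M + z) + size (alone c isB)) (+-identityʳ M) (k*2≤2^n+alone c isB))
  λ M<k r≤s → no-large-cross m t t≤m (chosen c isB) (alone c isB) (chosen-cross-alone c isB)
    (≤-trans M<k (k≤chosen c isB))
    (subst (_≤ size (alone c isB)) (sumTo-C-double N t) r≤s)
  where
  N = suc (m * 2)
  M = 2 ^ N
  r = sumTo t (suc N C_) + N C t

theorem4p2 : (∀ (n p : ℕ) → 5 ≤ n → n % 2 ≡ 1 → (n + 1) / 2 ≤ p → p ≤ n ∸ 2 →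
    BChromatic≤ (AdjQ n p)
    (2 ^ (n ∸ 1) + ⌈ sumTo (p ∸ (n ∸ 1) / 2) (λ i → n C i) /2⌉ ∸ 1))
    ×
    (∀ (n p : ℕ) → 6 ≤ n → n % 2 ≡ 0 → n / 2 + 1 ≤ p → p ≤ n ∸ 2 →
    BChromatic≤ (AdjQ n p)
    (2 ^ (n ∸ 1)
    + ⌈ sumTo (p ∸ n / 2) (λ i → n C i) + (n ∸ 1) C (p ∸ n / 2) /2⌉ ∸ 1))
theorem4p2 = odd , even
  where
  -- `q` stands for `m * 2 / 2`, which equals `m` only by a lemma; as a variable it can be
  -- eliminated by matching.
  odd′ : ∀ m q p → q ≡ m → suc (m * 2 + 1) / 2 ≤ p → p ≤ suc (m * 2) ∸ 2 →
    BChromatic≤ (AdjQ (suc (m * 2)) p) (2 ^ (m * 2) + ⌈ sumTo (p ∸ q) (suc (m * 2) C_) /2⌉ ∸ 1)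
  odd′ m q p refl lo hi = subst
    (λ z → BChromatic≤ (AdjQ (suc (m * 2)) z) (2 ^ (m * 2) + ⌈ sumTo (p ∸ m) (suc (m * 2) C_) /2⌉ ∸ 1))
    (m+[n∸m]≡n m≤p)
    (bound-odd m (p ∸ m) (m≤n+o⇒m∸n≤o p m
      (≤-trans hi (≤-trans (m∸n≤m (m * 2) 1) (≤-reflexive (sym (m+m≡m*2 m)))))))
    where
    m≤p : m ≤ p
    m≤p = ≤-trans (subst (_≤ suc (m * 2 + 1) / 2) (m*n/n≡m m 2)
      (/-monoˡ-≤ 2 (m≤n⇒m≤1+n (m≤m+n (m * 2) 1)))) lo

  odd : ∀ (n p : ℕ) → 5 ≤ n → n % 2 ≡ 1 → (n + 1) / 2 ≤ p → p ≤ n ∸ 2 →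
    BChromatic≤ (AdjQ n p) (2 ^ (n ∸ 1) + ⌈ sumTo (p ∸ (n ∸ 1) / 2) (λ i → n C i) /2⌉ ∸ 1)
  odd n p _ n%2≡1 with n / 2 | trans (m≡m%n+[m/n]*n n 2) (cong (_+ n / 2 * 2) n%2≡1)
  ... | m | refl = odd′ m (m * 2 / 2) p (m*n/n≡m m 2)

  even′ : ∀ m q p → q ≡ suc m → q + 1 ≤ p → p ≤ suc m * 2 ∸ 2 →
    BChromatic≤ (AdjQ (suc m * 2) p)
      (2 ^ suc (m * 2) + ⌈ sumTo (p ∸ q) (suc m * 2 C_) + suc (m * 2) C (p ∸ q) /2⌉ ∸ 1)
  even′ m q p refl lo hi = subst
    (λ z → BChromatic≤ (AdjQ (suc m * 2) z)
      (2 ^ suc (m * 2) + ⌈ sumTo (p ∸ suc m) (suc m * 2 C_) + suc (m * 2) C (p ∸ suc m) /2⌉ ∸ 1))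
    (m+[n∸m]≡n (≤-trans (m≤m+n (suc m) 1) lo))
    (bound-even m (p ∸ suc m) (m≤n+o⇒m∸n≤o p (suc m)
      (≤-trans hi (≤-trans (≤-reflexive (sym (m+m≡m*2 m))) (n≤1+n _)))))

  even : ∀ (n p : ℕ) → 6 ≤ n → n % 2 ≡ 0 → n / 2 + 1 ≤ p → p ≤ n ∸ 2 →
    BChromatic≤ (AdjQ n p)
      (2 ^ (n ∸ 1) + ⌈ sumTo (p ∸ n / 2) (λ i → n C i) + (n ∸ 1) C (p ∸ n / 2) /2⌉ ∸ 1)
  even n p 6≤n n%2≡0 = go (n / 2) refl (trans (m≡m%n+[m/n]*n n 2) (cong (_+ n / 2 * 2) n%2≡0)) 6≤n
    where
    go : ∀ m → n / 2 ≡ m → n ≡ n / 2 * 2 → 6 ≤ n → n / 2 + 1 ≤ p → p ≤ n ∸ 2 →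
      BChromatic≤ (AdjQ n p)
        (2 ^ (n ∸ 1) + ⌈ sumTo (p ∸ n / 2) (λ i → n C i) + (n ∸ 1) C (p ∸ n / 2) /2⌉ ∸ 1)
    -- Splitting off the zero case lets `n ∸ 1` compute to `suc (m * 2)` in the other one.
    go zero    eq n≡ 6≤n = contradiction (subst (6 ≤_) (trans n≡ (cong (_* 2) eq)) 6≤n) λ ()
    go (suc m) eq n≡ 6≤n with trans n≡ (cong (_* 2) eq)
    ... | refl = even′ m (suc m * 2 / 2) p eq
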